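{- For $n=0,1,2,\ldots$ let $$q_n=\sum_{k=0}^n\binom nk^2k!,\qquad p_n=\sum_{k=0}^n\binom nk^2k!\,(2H_{n-k}-H_k).$$ Then the sequence $\{q_n\}_{n\ge0}$ is a solution of the second-order homogeneous linear recurrence $$q_{n+2}-2(n+2)q_{n+1}+(n+1)^2q_n=0\qquad(n\ge0)$$ with initial values $q_0=1$, $q_1=2$, and the sequence $\{p_n\}_{n\ge0}$ is a solution of the second-order inhomogeneous linear recurrence $$p_{n+2}-2(n+2)p_{n+1}+(n+1)^2p_n=-\frac{n}{n+2}\qquad(n\ge0)$$ with initial values $p_0=0$, $p_1=1$.
   Context: $H_m=\sum_{j=1}^m1/j$ is the $m$th harmonic number, $H_0=0$. -}

module Defs where

open import Data.Fin.Base using (toℕ)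
open import Data.Integer.Base using (+_)
open import Data.Nat.Base as ℕ using (ℕ; suc; _∸_; _^_; _!)
open import Data.Nat.Combinatorics using (_C_)
open import Data.Rational using (ℚ; _*_; _-_; _/_)
open import Data.Rational.Properties using (+-0-commutativeMonoid)

open import Algebra.Properties.CommutativeMonoid.Sum +-0-commutativeMonoid
  using (sum-syntax; sum⁺-syntax)

fromℕ : ℕ → ℚ
fromℕ n = + n / 1

-- The index of sum-syntax starts at 0, hence the shift from j to suc j.
H : ℕ → ℚ
H m = ∑[ j < m ] (+ 1 / suc (toℕ j))

q : ℕ → ℚ
q n = ∑[ k ≤ n ] fromℕ ((n C toℕ k) ^ 2 ℕ.* toℕ k !)

p : ℕ → ℚ
p n = ∑[ k ≤ n ] (fromℕ ((n C toℕ k) ^ 2 ℕ.* toℕ k !)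
                  * (fromℕ 2 * H (n ∸ toℕ k) - H (toℕ k)))

{-# OPTIONS --safe #-}
-- Index the summands by pairs with k + m = n, so that the weight is
-- w(k,m) = (k+m)!² / (k! m!²).  It satisfies (k+1) w(k+1,m) = (n+1)² w(k,m) and
-- (m+1)² w(k,m+1) = (n+1)² w(k,m), so a factor k or m² in a sum over k + m = n+1 lowers it
-- to a sum over k + m = n.  With h = 2 H_m - H_k, whose increments are -1/(k+1) and 2/(m+1), and
-- the moments Q = Σ w, M = Σ m w, P = Σ h w, R = Σ m h w, splitting n+1 = k + m in front of
-- each sum yields, for N = n+1,
--   Q' = N Q + Q + M,                    M' = N (Q + M),
--   P' = N P + P + R - Q + 2/N,          R' = N (R + P) + M + Q + 1,
-- and eliminating M and R gives the two second-order recurrences.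
module Submission where

open import Algebra.Bundles using (CommutativeRing)
open import Data.Fin.Base using (toℕ)
open import Data.Integer.Base as ℤ using (+_)
import Data.Integer.Properties as ℤ
open import Data.Nat.Base as ℕ using (ℕ; zero; suc; _∸_; _!)
open import Data.Nat.Combinatorics using (_C_; nCk≡n!/k![n-k]!; k![n∸k]!∣n!)
open import Data.Nat.DivMod using (m/n*n≡m)
import Data.Nat.Properties as ℕ
open import Data.Nat.Solver renaming (module +-*-Solver to ℕ-Solver)
open import Data.Product.Base using (_×_; _,_)
open import Data.Rational using (ℚ; 0ℚ; 1ℚ; _+_; _*_; _-_; -_; _/_; toℚᵘ; fromℚᵘ)
open import Data.Rational.Properties
open import Data.Rational.Solver using (module +-*-Solver)
open import Data.Rational.Unnormalised.Base as ℚᵘ using (mkℚᵘ; *≡*)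
import Data.Rational.Unnormalised.Properties as ℚᵘ
open import Defs
open import Relation.Binary.PropositionalEquality

open import Algebra.Properties.Semiring.Sum (CommutativeRing.semiring +-*-commutativeRing)
  using (sum-syntax; sum⁺-syntax; ∑-distrib-+; *-distribˡ-sum)

-- Arithmetic of fractions with natural numerator and denominator.

fromℚᵘ-homo-+ : ∀ x y → fromℚᵘ (x ℚᵘ.+ y) ≡ fromℚᵘ x + fromℚᵘ y
fromℚᵘ-homo-+ x y = toℚᵘ-injective (begin
  toℚᵘ (fromℚᵘ (x ℚᵘ.+ y))                ≈⟨ toℚᵘ-fromℚᵘ (x ℚᵘ.+ y) ⟩
  x ℚᵘ.+ y                                ≈⟨ ℚᵘ.+-cong (toℚᵘ-fromℚᵘ x) (toℚᵘ-fromℚᵘ y) ⟨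
  toℚᵘ (fromℚᵘ x) ℚᵘ.+ toℚᵘ (fromℚᵘ y)    ≈⟨ toℚᵘ-homo-+ (fromℚᵘ x) (fromℚᵘ y) ⟨
  toℚᵘ (fromℚᵘ x + fromℚᵘ y)              ∎)
  where open ℚᵘ.≃-Reasoning

fromℚᵘ-homo-* : ∀ x y → fromℚᵘ (x ℚᵘ.* y) ≡ fromℚᵘ x * fromℚᵘ y
fromℚᵘ-homo-* x y = toℚᵘ-injective (begin
  toℚᵘ (fromℚᵘ (x ℚᵘ.* y))                ≈⟨ toℚᵘ-fromℚᵘ (x ℚᵘ.* y) ⟩
  x ℚᵘ.* y                                ≈⟨ ℚᵘ.*-cong (toℚᵘ-fromℚᵘ x) (toℚᵘ-fromℚᵘ y) ⟨
  toℚᵘ (fromℚᵘ x) ℚᵘ.* toℚᵘ (fromℚᵘ y)    ≈⟨ toℚᵘ-homo-* (fromℚᵘ x) (fromℚᵘ y) ⟨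
  toℚᵘ (fromℚᵘ x * fromℚᵘ y)              ∎)
  where open ℚᵘ.≃-Reasoning

-- `fromℕ a` is by definition `fromℚᵘ` of the fraction a/1, so additivity is inherited from
-- unnormalised fractions.
fromℕ-+ : ∀ a b → fromℕ (a ℕ.+ b) ≡ fromℕ a + fromℕ b
fromℕ-+ a b = trans
  (cong (_/ 1) (sym (cong₂ ℤ._+_ (ℤ.*-identityʳ (+ a)) (ℤ.*-identityʳ (+ b)))))
  (fromℚᵘ-homo-+ (mkℚᵘ (+ a) 0) (mkℚᵘ (+ b) 0))

fromℕ-* : ∀ a b → fromℕ (a ℕ.* b) ≡ fromℕ a * fromℕ b
fromℕ-* a b = trans
  (cong (_/ 1) (ℤ.pos-* a b))
  (fromℚᵘ-homo-* (mkℚᵘ (+ a) 0) (mkℚᵘ (+ b) 0))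

/-as-* : ∀ a n → + a / suc n ≡ fromℕ a * (+ 1 / suc n)
/-as-* a n = trans
  (fromℚᵘ-cong {mkℚᵘ (+ a) n} {mkℚᵘ (+ a) 0 ℚᵘ.* mkℚᵘ (+ 1) n}
    (*≡* (cong₂ ℤ._*_ (sym (ℤ.*-identityʳ (+ a))) (cong +_ (ℕ.+-identityʳ (suc n))))))
  (fromℚᵘ-homo-* (mkℚᵘ (+ a) 0) (mkℚᵘ (+ 1) n))

suc*1/suc : ∀ n → fromℕ (suc n) * (+ 1 / suc n) ≡ 1ℚ
suc*1/suc n = trans (sym (/-as-* (suc n) n))
  (fromℚᵘ-cong {mkℚᵘ (+ suc n) n} {mkℚᵘ (+ 1) 0} (*≡* (ℤ.*-comm (+ suc n) (+ 1))))

-- Ratios of neighbouring binomial coefficients.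

binomial-factorial : ∀ k m → ((k ℕ.+ m) C k) ℕ.* (k ! ℕ.* m !) ≡ (k ℕ.+ m) !
binomial-factorial k m = begin
  ((k ℕ.+ m) C k) ℕ.* (k ! ℕ.* m !)
    ≡⟨ cong (λ l → ((k ℕ.+ m) C k) ℕ.* (k ! ℕ.* l !)) (ℕ.m+n∸m≡n k m) ⟨
  ((k ℕ.+ m) C k) ℕ.* (k ! ℕ.* (k ℕ.+ m ∸ k) !)
    ≡⟨ cong (ℕ._* (k ! ℕ.* (k ℕ.+ m ∸ k) !)) (nCk≡n!/k![n-k]! (ℕ.m≤m+n k m)) ⟩
  _
    ≡⟨ m/n*n≡m (k![n∸k]!∣n! (ℕ.m≤m+n k m)) ⟩
  (k ℕ.+ m) ! ∎
  where
  open ≡-Reasoning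
  instance _ = ℕ._!*_!≢0 k (k ℕ.+ m ∸ k)

-- Multiplied by k! m!, both sides become (k+m+1)!, because k+1 is absorbed into (k+1)!.
binomial-suc-k : ∀ k m → suc k ℕ.* ((suc k ℕ.+ m) C suc k) ≡ suc (k ℕ.+ m) ℕ.* ((k ℕ.+ m) C k)
binomial-suc-k k m = ℕ.*-cancelʳ-≡ _ _ (k ! ℕ.* m !) (begin
  suc k ℕ.* c′ ℕ.* (k ! ℕ.* m !)
    ≡⟨ solve 4 (λ a b c d → a :* b :* (c :* d) := b :* (a :* c :* d)) refl (suc k) c′ (k !) (m !) ⟩
  c′ ℕ.* (suc k ! ℕ.* m !)          ≡⟨ binomial-factorial (suc k) m ⟩
  suc (k ℕ.+ m) ℕ.* (k ℕ.+ m) !     ≡⟨ cong (suc (k ℕ.+ m) ℕ.*_) (binomial-factorial k m) ⟨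
  suc (k ℕ.+ m) ℕ.* (c ℕ.* (k ! ℕ.* m !)) ≡⟨ ℕ.*-assoc (suc (k ℕ.+ m)) c _ ⟨
  suc (k ℕ.+ m) ℕ.* c ℕ.* (k ! ℕ.* m !) ∎)
  where
  open ≡-Reasoning
  open ℕ-Solver
  c = (k ℕ.+ m) C k
  c′ = (suc k ℕ.+ m) C suc k
  instance _ = ℕ._!*_!≢0 k m

binomial-suc-m : ∀ k m → suc m ℕ.* ((k ℕ.+ suc m) C k) ≡ suc (k ℕ.+ m) ℕ.* ((k ℕ.+ m) C k)
binomial-suc-m k m = ℕ.*-cancelʳ-≡ _ _ (k ! ℕ.* m !) (begin
  suc m ℕ.* c′ ℕ.* (k ! ℕ.* m !)
    ≡⟨ solve 4 (λ a b c d → a :* b :* (c :* d) := b :* (c :* (a :* d)))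
         refl (suc m) c′ (k !) (m !) ⟩
  c′ ℕ.* (k ! ℕ.* suc m !)          ≡⟨ binomial-factorial k (suc m) ⟩
  (k ℕ.+ suc m) !                   ≡⟨ cong _! (ℕ.+-suc k m) ⟩
  suc (k ℕ.+ m) ℕ.* (k ℕ.+ m) !     ≡⟨ cong (suc (k ℕ.+ m) ℕ.*_) (binomial-factorial k m) ⟨
  suc (k ℕ.+ m) ℕ.* (c ℕ.* (k ! ℕ.* m !)) ≡⟨ ℕ.*-assoc (suc (k ℕ.+ m)) c _ ⟨
  suc (k ℕ.+ m) ℕ.* c ℕ.* (k ! ℕ.* m !) ∎)
  where
  open ≡-Reasoning
  open ℕ-Solver
  c = (k ℕ.+ m) C k
  c′ = (k ℕ.+ suc m) C k
  instance _ = ℕ._!*_!≢0 k m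

-- The weights w(k,m) as natural numbers.

private
  square-out : ∀ a b c → (a ℕ.* b) ℕ.^ 2 ℕ.* c ≡ a ℕ.* a ℕ.* (b ℕ.^ 2 ℕ.* c)
  square-out = solve 3 (λ a b c → (a :* b) :^ 2 :* c := a :* a :* (b :^ 2 :* c)) refl
    where open ℕ-Solver

  square-in : ∀ a b c → a ℕ.* (b ℕ.^ 2 ℕ.* (a ℕ.* c)) ≡ (a ℕ.* b) ℕ.^ 2 ℕ.* c
  square-in = solve 3 (λ a b c → a :* (b :^ 2 :* (a :* c)) := (a :* b) :^ 2 :* c) refl
    where open ℕ-Solver

-- The opaque definitions below keep the conversion checker from unfolding the
-- arithmetic of _C_ and ℚ (gcd normalisation), which exhausts memory on open terms.
opaque
  weightℕ : ℕ → ℕ → ℕ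
  weightℕ k m = ((k ℕ.+ m) C k) ℕ.^ 2 ℕ.* k !

  weightℕ-unfold : ∀ k m → weightℕ k m ≡ ((k ℕ.+ m) C k) ℕ.^ 2 ℕ.* k !
  weightℕ-unfold k m = refl

  weightℕ-zero : ∀ m → weightℕ 0 m ≡ 1
  weightℕ-zero m = refl

  -- A single factor k+1 suffices on the left: (k+1)! inside the weight supplies the second one,
  -- which completes the square of the binomial ratio.
  weightℕ-suc-k : ∀ k m → suc k ℕ.* weightℕ (suc k) m ≡ suc (k ℕ.+ m) ℕ.* suc (k ℕ.+ m) ℕ.* weightℕ k m
  weightℕ-suc-k k m = trans (square-in (suc k) ((suc k ℕ.+ m) C suc k) (k !))
    (trans (cong (λ x → x ℕ.^ 2 ℕ.* k !) (binomial-suc-k k m))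
      (square-out (suc (k ℕ.+ m)) ((k ℕ.+ m) C k) (k !)))

  -- The factor k! does not change with m, so both factors m+1 of the squared binomial ratio must
  -- come from outside.
  weightℕ-suc-m : ∀ k m → suc m ℕ.* suc m ℕ.* weightℕ k (suc m) ≡ suc (k ℕ.+ m) ℕ.* suc (k ℕ.+ m) ℕ.* weightℕ k m
  weightℕ-suc-m k m = trans (sym (square-out (suc m) ((k ℕ.+ suc m) C k) (k !)))
    (trans (cong (λ x → x ℕ.^ 2 ℕ.* k !) (binomial-suc-m k m))
      (square-out (suc (k ℕ.+ m)) ((k ℕ.+ m) C k) (k !)))

-- Natural numbers and reciprocals in the rationals, and increments of harmonic numbers.

∑-last : ∀ n (f : ℕ → ℚ) → ∑[ j ≤ n ] f (toℕ j) ≡ ∑[ j < n ] f (toℕ j) + f n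
∑-last zero    f = +-comm (f 0) 0ℚ
∑-last (suc n) f = trans (cong (λ x → f 0 + x) (∑-last n (λ j → f (suc j)))) (sym (+-assoc (f 0) _ _))

opaque
  ι : ℕ → ℚ
  ι = fromℕ

  ι-unfold : ∀ n → ι n ≡ fromℕ n
  ι-unfold n = refl

  ι-0 : ι 0 ≡ 0ℚ
  ι-0 = refl

  ι-1 : ι 1 ≡ 1ℚ
  ι-1 = refl

  ι-+ : ∀ a b → ι (a ℕ.+ b) ≡ ι a + ι b
  ι-+ = fromℕ-+

  ι-* : ∀ a b → ι (a ℕ.* b) ≡ ι a * ι b
  ι-* = fromℕ-*

  recip : ℕ → ℚ
  recip n = + 1 / suc n

  ι*recip : ∀ n → ι (suc n) * recip n ≡ 1ℚ
  ι*recip = suc*1/suc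

  /-as-ι*recip : ∀ a n → + a / suc n ≡ ι a * recip n
  /-as-ι*recip = /-as-*

  -- Sums unfold from their first term, whereas the harmonic increment is the last term; `∑-last`
  -- bridges the two.
  H-suc : ∀ n → H (suc n) ≡ H n + recip n
  H-suc n = ∑-last n recip

open +-*-Solver

-- Sums over the pairs with k + m = n.

opaque
  diagSum : ℕ → (ℕ → ℕ → ℚ) → ℚ
  diagSum n f = ∑[ i ≤ n ] f (toℕ i) (n ∸ toℕ i)

  diagSum-unfold : ∀ n f → diagSum n f ≡ ∑[ i ≤ n ] f (toℕ i) (n ∸ toℕ i)
  diagSum-unfold n f = refl

  -- The pointwise proof receives k + m = n, so a factor depending on n can be rewritten in terms of
  -- k and m inside each summand.
  diagSum-cong : ∀ n {f g} → (∀ k m → k ℕ.+ m ≡ n → f k m ≡ g k m) → diagSum n f ≡ diagSum n g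
  diagSum-cong zero    f≡g = cong (_+ 0ℚ) (f≡g 0 0 refl)
  diagSum-cong (suc n) f≡g = cong₂ _+_ (f≡g 0 (suc n) refl) (diagSum-cong n (λ k m eq → f≡g (suc k) m (cong suc eq)))

  diagSum-first : ∀ n f → diagSum (suc n) f ≡ f 0 (suc n) + diagSum n (λ k m → f (suc k) m)
  diagSum-first n f = refl

  diagSum-last : ∀ n f → diagSum (suc n) f ≡ diagSum n (λ k m → f k (suc m)) + f (suc n) 0
  diagSum-last zero    f = solve 2 (λ x y → x :+ (y :+ con 0ℚ) := (x :+ con 0ℚ) :+ y) refl (f 0 1) (f 1 0)
  diagSum-last (suc n) f = trans
    (cong (λ x → f 0 (suc (suc n)) + x) (diagSum-last n (λ k → f (suc k))))
    (sym (+-assoc (f 0 (suc (suc n))) _ _))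

  diagSum-+ : ∀ n f g → diagSum n (λ k m → f k m + g k m) ≡ diagSum n f + diagSum n g
  diagSum-+ n f g = ∑-distrib-+ {suc n} (λ i → f (toℕ i) (n ∸ toℕ i)) (λ i → g (toℕ i) (n ∸ toℕ i))

  diagSum-* : ∀ n c f → diagSum n (λ k m → c * f k m) ≡ c * diagSum n f
  diagSum-* n c f = sym (*-distribˡ-sum {suc n} c (λ i → f (toℕ i) (n ∸ toℕ i)))

-- Weighted sums and the rules that lower n+1 to n.

weight : ℕ → ℕ → ℚ
weight k m = ι (weightℕ k m)

suc² : ℕ → ℚ
suc² n = ι (suc n) * ι (suc n)

private
  ι-suc² : ∀ n x → ι (suc n ℕ.* suc n ℕ.* x) ≡ suc² n * ι x
  ι-suc² n x = trans (ι-* (suc n ℕ.* suc n) x) (cong (_* ι x) (ι-* (suc n) (suc n)))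

weight-suc-k : ∀ k m → ι (suc k) * weight (suc k) m ≡ suc² (k ℕ.+ m) * weight k m
weight-suc-k k m = trans (sym (ι-* (suc k) (weightℕ (suc k) m)))
  (trans (cong ι (weightℕ-suc-k k m)) (ι-suc² (k ℕ.+ m) (weightℕ k m)))

weight-suc-m : ∀ k m → suc² m * weight k (suc m) ≡ suc² (k ℕ.+ m) * weight k m
weight-suc-m k m = trans (sym (ι-suc² m (weightℕ k (suc m))))
  (trans (cong ι (weightℕ-suc-m k m)) (ι-suc² (k ℕ.+ m) (weightℕ k m)))

weight-zero : ∀ m → weight 0 m ≡ 1ℚ
weight-zero m = trans (cong ι (weightℕ-zero m)) ι-1

weightedSum : ℕ → (ℕ → ℕ → ℚ) → ℚ
weightedSum n φ = diagSum n (λ k m → weight k m * φ k m)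

weightedSum-cong : ∀ n {φ ψ} → (∀ k m → φ k m ≡ ψ k m) → weightedSum n φ ≡ weightedSum n ψ
weightedSum-cong n φ≡ψ = diagSum-cong n (λ k m _ → cong (λ x → weight k m * x) (φ≡ψ k m))

weightedSum-+ : ∀ n φ ψ → weightedSum n (λ k m → φ k m + ψ k m) ≡ weightedSum n φ + weightedSum n ψ
weightedSum-+ n φ ψ = trans
  (diagSum-cong n (λ k m _ → *-distribˡ-+ (weight k m) (φ k m) (ψ k m)))
  (diagSum-+ n _ _)

weightedSum-* : ∀ n c φ → weightedSum n (λ k m → c * φ k m) ≡ c * weightedSum n φ
weightedSum-* n c φ = trans
  (diagSum-cong n (λ k m _ → solve 3 (λ x y z → x :* (y :* z) := y :* (x :* z)) refl (weight k m) c (φ k m)))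
  (diagSum-* n c _)

-- The factor k kills the boundary term k = 0, and the other terms are reindexed by the weight ratio
-- in k.
weightedSum-shift-k : ∀ n (φ : ℕ → ℕ → ℚ) →
  weightedSum (suc n) (λ k m → ι k * φ k m) ≡ suc² n * weightedSum n (λ k m → φ (suc k) m)
weightedSum-shift-k n φ = begin
  weightedSum (suc n) (λ k m → ι k * φ k m)
    ≡⟨ diagSum-first n _ ⟩
  weight 0 (suc n) * (ι 0 * φ 0 (suc n)) + rest
    ≡⟨ cong (λ z → weight 0 (suc n) * (z * φ 0 (suc n)) + rest) ι-0 ⟩
  weight 0 (suc n) * (0ℚ * φ 0 (suc n)) + rest
    ≡⟨ solve 3 (λ x y z → x :* (con 0ℚ :* y) :+ z := z) refl (weight 0 (suc n)) (φ 0 (suc n)) rest ⟩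
  rest
    ≡⟨ diagSum-cong n step ⟩
  diagSum n (λ k m → suc² n * (weight k m * φ (suc k) m))
    ≡⟨ diagSum-* n (suc² n) _ ⟩
  suc² n * weightedSum n (λ k m → φ (suc k) m) ∎
  where
  open ≡-Reasoning
  rest = diagSum n (λ k m → weight (suc k) m * (ι (suc k) * φ (suc k) m))
  step : ∀ k m → k ℕ.+ m ≡ n →
         weight (suc k) m * (ι (suc k) * φ (suc k) m) ≡ suc² n * (weight k m * φ (suc k) m)
  step k m refl = begin
    weight (suc k) m * (ι (suc k) * φ (suc k) m)
      ≡⟨ solve 3 (λ x y z → x :* (y :* z) := (y :* x) :* z)
           refl (weight (suc k) m) (ι (suc k)) (φ (suc k) m) ⟩
    (ι (suc k) * weight (suc k) m) * φ (suc k) m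
      ≡⟨ cong (_* φ (suc k) m) (weight-suc-k k m) ⟩
    (suc² (k ℕ.+ m) * weight k m) * φ (suc k) m
      ≡⟨ *-assoc (suc² (k ℕ.+ m)) (weight k m) (φ (suc k) m) ⟩
    suc² (k ℕ.+ m) * (weight k m * φ (suc k) m) ∎

-- Two factors m are taken because the weight ratio in m involves (m+1)²; the boundary term m = 0
-- vanishes.
weightedSum-shift-m : ∀ n (φ : ℕ → ℕ → ℚ) →
  weightedSum (suc n) (λ k m → ι m * (ι m * φ k m)) ≡ suc² n * weightedSum n (λ k m → φ k (suc m))
weightedSum-shift-m n φ = begin
  weightedSum (suc n) (λ k m → ι m * (ι m * φ k m))
    ≡⟨ diagSum-last n _ ⟩
  rest + weight (suc n) 0 * (ι 0 * (ι 0 * φ (suc n) 0))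
    ≡⟨ cong (λ z → rest + weight (suc n) 0 * (z * (z * φ (suc n) 0))) ι-0 ⟩
  rest + weight (suc n) 0 * (0ℚ * (0ℚ * φ (suc n) 0))
    ≡⟨ solve 3 (λ x y z → z :+ x :* (con 0ℚ :* (con 0ℚ :* y)) := z)
         refl (weight (suc n) 0) (φ (suc n) 0) rest ⟩
  rest
    ≡⟨ diagSum-cong n step ⟩
  diagSum n (λ k m → suc² n * (weight k m * φ k (suc m)))
    ≡⟨ diagSum-* n (suc² n) _ ⟩
  suc² n * weightedSum n (λ k m → φ k (suc m)) ∎
  where
  open ≡-Reasoning
  rest = diagSum n (λ k m → weight k (suc m) * (ι (suc m) * (ι (suc m) * φ k (suc m))))
  step : ∀ k m → k ℕ.+ m ≡ n →
         weight k (suc m) * (ι (suc m) * (ι (suc m) * φ k (suc m))) ≡ suc² n * (weight k m * φ k (suc m))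
  step k m refl = begin
    weight k (suc m) * (ι (suc m) * (ι (suc m) * φ k (suc m)))
      ≡⟨ solve 3 (λ x y z → x :* (y :* (y :* z)) := (y :* y :* x) :* z)
           refl (weight k (suc m)) (ι (suc m)) (φ k (suc m)) ⟩
    (suc² m * weight k (suc m)) * φ k (suc m)
      ≡⟨ cong (_* φ k (suc m)) (weight-suc-m k m) ⟩
    (suc² (k ℕ.+ m) * weight k m) * φ k (suc m)
      ≡⟨ *-assoc (suc² (k ℕ.+ m)) (weight k m) (φ k (suc m)) ⟩
    suc² (k ℕ.+ m) * (weight k m * φ k (suc m)) ∎

-- Each summand is split by n+1 = k + m. The part with k can be lowered at once; the part with a
-- single m stays at level n+1.
weightedSum-diagonal : ∀ n (φ : ℕ → ℕ → ℚ) →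
  ι (suc n) * weightedSum (suc n) φ
    ≡ suc² n * weightedSum n (λ k m → φ (suc k) m) + weightedSum (suc n) (λ k m → ι m * φ k m)
weightedSum-diagonal n φ = begin
  ι (suc n) * weightedSum (suc n) φ
    ≡⟨ diagSum-* (suc n) (ι (suc n)) _ ⟨
  diagSum (suc n) (λ k m → ι (suc n) * (weight k m * φ k m))
    ≡⟨ diagSum-cong (suc n) step ⟩
  weightedSum (suc n) (λ k m → ι k * φ k m + ι m * φ k m)
    ≡⟨ weightedSum-+ (suc n) _ _ ⟩
  weightedSum (suc n) (λ k m → ι k * φ k m) + weightedSum (suc n) (λ k m → ι m * φ k m)
    ≡⟨ cong (_+ weightedSum (suc n) (λ k m → ι m * φ k m)) (weightedSum-shift-k n φ) ⟩
  suc² n * weightedSum n (λ k m → φ (suc k) m) + weightedSum (suc n) (λ k m → ι m * φ k m) ∎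
  where
  open ≡-Reasoning
  step : ∀ k m → k ℕ.+ m ≡ suc n →
         ι (suc n) * (weight k m * φ k m) ≡ weight k m * (ι k * φ k m + ι m * φ k m)
  step k m eq = begin
    ι (suc n) * (weight k m * φ k m)
      ≡⟨ cong (λ x → ι x * (weight k m * φ k m)) eq ⟨
    ι (k ℕ.+ m) * (weight k m * φ k m)
      ≡⟨ cong (_* (weight k m * φ k m)) (ι-+ k m) ⟩
    (ι k + ι m) * (weight k m * φ k m)
      ≡⟨ solve 4 (λ a b x y → (a :+ b) :* (x :* y) := x :* (a :* y :+ b :* y))
           refl (ι k) (ι m) (weight k m) (φ k m) ⟩
    weight k m * (ι k * φ k m + ι m * φ k m) ∎

-- The harmonic factor and the sums of its increments.

2ℚ : ℚ
2ℚ = fromℕ 2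

h : ℕ → ℕ → ℚ
h k m = 2ℚ * H m - H k

h-suc-k : ∀ k m → h (suc k) m ≡ h k m - recip k
h-suc-k k m = trans (cong (λ x → 2ℚ * H m - x) (H-suc k))
  (solve 3 (λ x y z → x :- (y :+ z) := x :- y :- z) refl (2ℚ * H m) (H k) (recip k))

h-suc-m : ∀ k m → h k (suc m) ≡ h k m + 2ℚ * recip m
h-suc-m k m = trans (cong (λ x → 2ℚ * x - H k) (H-suc m))
  (solve 4 (λ c x y z → c :* (x :+ y) :- z := c :* x :- z :+ c :* y) refl 2ℚ (H m) (recip m) (H k))

-- Here the weight ratio is used upwards: 1/(k+1) cancels the factor k+1. Reindexing misses the pair
-- (0, n+1), whose contribution is `g (suc n)` since w(0,m) = 1.
weightedSum-recip-k : ∀ n (g : ℕ → ℚ) →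
  suc² n * weightedSum n (λ k m → recip k * g m) + g (suc n) ≡ weightedSum (suc n) (λ _ m → g m)
weightedSum-recip-k n g = begin
  suc² n * weightedSum n (λ k m → recip k * g m) + g (suc n)
    ≡⟨ cong (_+ g (suc n)) (trans (sym (diagSum-* n (suc² n) _)) (diagSum-cong n step)) ⟩
  diagSum n (λ k m → weight (suc k) m * g m) + g (suc n)
    ≡⟨ solve 2 (λ x y → x :+ y := con 1ℚ :* y :+ x)
         refl (diagSum n (λ k m → weight (suc k) m * g m)) (g (suc n)) ⟩
  1ℚ * g (suc n) + diagSum n (λ k m → weight (suc k) m * g m)
    ≡⟨ cong (λ x → x * g (suc n) + diagSum n (λ k m → weight (suc k) m * g m)) (weight-zero (suc n)) ⟨
  weight 0 (suc n) * g (suc n) + diagSum n (λ k m → weight (suc k) m * g m)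
    ≡⟨ diagSum-first n _ ⟨
  weightedSum (suc n) (λ _ m → g m) ∎
  where
  open ≡-Reasoning
  step : ∀ k m → k ℕ.+ m ≡ n → suc² n * (weight k m * (recip k * g m)) ≡ weight (suc k) m * g m
  step k m refl = begin
    suc² n * (weight k m * (recip k * g m))
      ≡⟨ *-assoc (suc² n) (weight k m) _ ⟨
    (suc² n * weight k m) * (recip k * g m)
      ≡⟨ cong (_* (recip k * g m)) (weight-suc-k k m) ⟨
    (ι (suc k) * weight (suc k) m) * (recip k * g m)
      ≡⟨ solve 4 (λ a b c d → (a :* b) :* (c :* d) := (a :* c) :* (b :* d))
           refl (ι (suc k)) (weight (suc k) m) (recip k) (g m) ⟩
    (ι (suc k) * recip k) * (weight (suc k) m * g m)
      ≡⟨ cong (_* (weight (suc k) m * g m)) (ι*recip k) ⟩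
    1ℚ * (weight (suc k) m * g m)
      ≡⟨ *-identityˡ _ ⟩
    weight (suc k) m * g m ∎

-- Of the two factors in (m+1)², the reciprocal cancels one. The other remains as m after reindexing
-- and makes the missing term m = 0 vanish.
weightedSum-recip-m : ∀ n → suc² n * weightedSum n (λ _ m → recip m) ≡ weightedSum (suc n) (λ _ m → ι m)
weightedSum-recip-m n = begin
  suc² n * weightedSum n (λ _ m → recip m)
    ≡⟨ trans (sym (diagSum-* n (suc² n) _)) (diagSum-cong n step) ⟩
  rest
    ≡⟨ solve 2 (λ x y → x := x :+ y :* con 0ℚ) refl (rest) (weight (suc n) 0) ⟩
  rest + weight (suc n) 0 * 0ℚ
    ≡⟨ cong (λ z → rest + weight (suc n) 0 * z) ι-0 ⟨
  rest + weight (suc n) 0 * ι 0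
    ≡⟨ diagSum-last n _ ⟨
  weightedSum (suc n) (λ _ m → ι m) ∎
  where
  open ≡-Reasoning
  rest = diagSum n (λ k m → weight k (suc m) * ι (suc m))
  step : ∀ k m → k ℕ.+ m ≡ n → suc² n * (weight k m * recip m) ≡ weight k (suc m) * ι (suc m)
  step k m refl = begin
    suc² n * (weight k m * recip m)
      ≡⟨ *-assoc (suc² n) (weight k m) _ ⟨
    (suc² n * weight k m) * recip m
      ≡⟨ cong (_* recip m) (weight-suc-m k m) ⟨
    (suc² m * weight k (suc m)) * recip m
      ≡⟨ solve 3 (λ a b c → a :* a :* b :* c := (a :* c) :* (b :* a))
           refl (ι (suc m)) (weight k (suc m)) (recip m) ⟩
    (ι (suc m) * recip m) * (weight k (suc m) * ι (suc m))
      ≡⟨ cong (_* (weight k (suc m) * ι (suc m))) (ι*recip m) ⟩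
    1ℚ * (weight k (suc m) * ι (suc m))
      ≡⟨ *-identityˡ _ ⟩
    weight k (suc m) * ι (suc m) ∎

-- The four moments and their first-order recurrences.

Q M P R : ℕ → ℚ
Q n = weightedSum n (λ _ _ → 1ℚ)
M n = weightedSum n (λ _ m → ι m)
P n = weightedSum n h
R n = weightedSum n (λ k m → ι m * h k m)

*-cancelˡ-suc : ∀ n {x y} → ι (suc n) * x ≡ ι (suc n) * y → x ≡ y
*-cancelˡ-suc n {x} {y} eq = trans (sym (undo x)) (trans (cong (recip n *_) eq) (undo y))
  where
  undo : ∀ x → recip n * (ι (suc n) * x) ≡ x
  undo x = trans (solve 3 (λ i N x → i :* (N :* x) := (N :* i) :* x) refl (recip n) (ι (suc n)) x)
    (trans (cong (_* x) (ι*recip n)) (*-identityˡ x))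

Q-diag : ∀ n → ι (suc n) * Q (suc n) ≡ suc² n * Q n + M (suc n)
Q-diag n = trans (weightedSum-diagonal n (λ _ _ → 1ℚ))
  (cong (λ x → suc² n * Q n + x) (weightedSum-cong (suc n) (λ _ m → *-identityʳ (ι m))))

-- The part left over by the splitting carries m², so it too drops to level n, as N² Q.
M-diag : ∀ n → ι (suc n) * M (suc n) ≡ suc² n * M n + suc² n * Q n
M-diag n = trans (weightedSum-diagonal n (λ _ m → ι m))
  (cong (λ x → suc² n * M n + x)
    (trans (weightedSum-cong (suc n) (λ _ m → cong (ι m *_) (sym (*-identityʳ (ι m)))))
      (weightedSum-shift-m n (λ _ _ → 1ℚ))))

-- Lowering k turns h into h - 1/(k+1). The defect, scaled by N², is Q(n+1) - 1; adding Q(n+1) on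
-- the left restores h, and the 1 is the boundary term.
P-diag : ∀ n → ι (suc n) * P (suc n) + Q (suc n) ≡ suc² n * P n + R (suc n) + 1ℚ
P-diag n = begin
  ι (suc n) * P (suc n) + Q (suc n)
    ≡⟨ cong₂ _+_ (weightedSum-diagonal n h) (sym (weightedSum-recip-k n (λ _ → 1ℚ))) ⟩
  suc² n * A + R (suc n) + (suc² n * B + 1ℚ)
    ≡⟨ solve 5 (λ s a b x y → s :* a :+ x :+ (s :* b :+ y) := s :* (a :+ b) :+ x :+ y)
         refl (suc² n) A B (R (suc n)) 1ℚ ⟩
  suc² n * (A + B) + R (suc n) + 1ℚ
    ≡⟨ cong (λ x → suc² n * x + R (suc n) + 1ℚ) (trans (sym (weightedSum-+ n _ _)) (weightedSum-cong n step)) ⟩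
  suc² n * P n + R (suc n) + 1ℚ ∎
  where
  open ≡-Reasoning
  A = weightedSum n (λ k m → h (suc k) m)
  B = weightedSum n (λ k m → recip k * 1ℚ)
  step : ∀ k m → h (suc k) m + recip k * 1ℚ ≡ h k m
  step k m = trans (cong (_+ recip k * 1ℚ) (h-suc-k k m))
    (solve 2 (λ x y → x :- y :+ y :* con 1ℚ := x) refl (h k m) (recip k))

-- The decrement of h in k costs M(n+1) - N, with boundary term N because now `g` is `ι`. The
-- increment 2/(m+1) in the part with m² yields 2 M(n+1).
R-diag : ∀ n → ι (suc n) * R (suc n) + M (suc n)
       ≡ suc² n * R n + (suc² n * P n + 2ℚ * M (suc n)) + ι (suc n)
R-diag n = begin
  ι (suc n) * R (suc n) + M (suc n)
    ≡⟨ cong₂ _+_ (weightedSum-diagonal n (λ k m → ι m * h k m)) (sym (weightedSum-recip-k n ι)) ⟩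
  suc² n * A + weightedSum (suc n) (λ k m → ι m * (ι m * h k m)) + (suc² n * B + ι (suc n))
    ≡⟨ cong (λ x → suc² n * A + x + (suc² n * B + ι (suc n))) square ⟩
  suc² n * A + (suc² n * P n + 2ℚ * M (suc n)) + (suc² n * B + ι (suc n))
    ≡⟨ solve 5 (λ s a b x y → s :* a :+ x :+ (s :* b :+ y) := s :* (a :+ b) :+ x :+ y)
         refl (suc² n) A B (suc² n * P n + 2ℚ * M (suc n)) (ι (suc n)) ⟩
  suc² n * (A + B) + (suc² n * P n + 2ℚ * M (suc n)) + ι (suc n)
    ≡⟨ cong (λ x → suc² n * x + (suc² n * P n + 2ℚ * M (suc n)) + ι (suc n))
         (trans (sym (weightedSum-+ n _ _)) (weightedSum-cong n step)) ⟩
  suc² n * R n + (suc² n * P n + 2ℚ * M (suc n)) + ι (suc n) ∎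
  where
  open ≡-Reasoning
  A = weightedSum n (λ k m → ι m * h (suc k) m)
  B = weightedSum n (λ k m → recip k * ι m)
  step : ∀ k m → ι m * h (suc k) m + recip k * ι m ≡ ι m * h k m
  step k m = trans (cong (λ x → ι m * x + recip k * ι m) (h-suc-k k m))
    (solve 3 (λ x y z → z :* (x :- y) :+ y :* z := z :* x) refl (h k m) (recip k) (ι m))
  rₘ = weightedSum n (λ _ m → recip m)
  square : weightedSum (suc n) (λ k m → ι m * (ι m * h k m)) ≡ suc² n * P n + 2ℚ * M (suc n)
  square = begin
    weightedSum (suc n) (λ k m → ι m * (ι m * h k m))
      ≡⟨ weightedSum-shift-m n h ⟩
    suc² n * weightedSum n (λ k m → h k (suc m))
      ≡⟨ cong (suc² n *_) (trans (weightedSum-cong n h-suc-m) (weightedSum-+ n _ _)) ⟩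
    suc² n * (P n + weightedSum n (λ _ m → 2ℚ * recip m))
      ≡⟨ cong (λ x → suc² n * (P n + x)) (weightedSum-* n 2ℚ (λ _ m → recip m)) ⟩
    suc² n * (P n + 2ℚ * rₘ)
      ≡⟨ solve 4 (λ s x c y → s :* (x :+ c :* y) := s :* x :+ c :* (s :* y))
           refl (suc² n) (P n) 2ℚ rₘ ⟩
    suc² n * P n + 2ℚ * (suc² n * rₘ)
      ≡⟨ cong (λ x → suc² n * P n + 2ℚ * x) (weightedSum-recip-m n) ⟩
    suc² n * P n + 2ℚ * M (suc n) ∎

M-suc : ∀ n → M (suc n) ≡ ι (suc n) * (Q n + M n)
M-suc n = *-cancelˡ-suc n (trans (M-diag n)
  (solve 3 (λ N m x → N :* N :* m :+ N :* N :* x := N :* (N :* (x :+ m))) refl (ι (suc n)) (M n) (Q n)))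

Q-suc : ∀ n → Q (suc n) ≡ ι (suc n) * Q n + Q n + M n
Q-suc n = *-cancelˡ-suc n (trans (Q-diag n) (trans (cong (λ x → suc² n * Q n + x) (M-suc n))
  (solve 3 (λ N m x → N :* N :* x :+ N :* (x :+ m) := N :* (N :* x :+ x :+ m)) refl (ι (suc n)) (M n) (Q n))))

solve-for : ∀ {x y z} → x + y ≡ z → x ≡ z - y
solve-for {x} {y} refl = solve 2 (λ x y → x := x :+ y :- y) refl x y

R-suc : ∀ n → R (suc n) ≡ ι (suc n) * (R n + P n) + M n + Q n + 1ℚ
R-suc n = *-cancelˡ-suc n (trans (solve-for (R-diag n))
  (trans (cong (λ x → suc² n * R n + (suc² n * P n + 2ℚ * x) + ι (suc n) - x) (M-suc n))
    (solve 5 (λ N m x ρ π →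
        N :* N :* ρ :+ (N :* N :* π :+ con 2ℚ :* (N :* (x :+ m))) :+ N :- N :* (x :+ m)
        := N :* (N :* (ρ :+ π) :+ m :+ x :+ con 1ℚ))
      refl (ι (suc n)) (M n) (Q n) (R n) (P n))))

P-suc : ∀ n → P (suc n) ≡ ι (suc n) * P n + P n + R n - Q n + 2ℚ * recip n
P-suc n = *-cancelˡ-suc n (begin
  N * P (suc n)
    ≡⟨ solve-for (P-diag n) ⟩
  N * N * P n + R (suc n) + 1ℚ - Q (suc n)
    ≡⟨ cong₂ (λ x y → N * N * P n + x + 1ℚ - y) (R-suc n) (Q-suc n) ⟩
  N * N * P n + (N * (R n + P n) + M n + Q n + 1ℚ) + 1ℚ - (N * Q n + Q n + M n)
    -- One unit comes from `P-diag` and one from `R-suc`; their sum 2 is the only term without a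
    -- factor N, hence the summand 2/N in the result.
    ≡⟨ solve 5 (λ N m x ρ π →
         N :* N :* π :+ (N :* (ρ :+ π) :+ m :+ x :+ con 1ℚ) :+ con 1ℚ :- (N :* x :+ x :+ m)
         := N :* (N :* π :+ π :+ ρ :- x) :+ con 2ℚ :* con 1ℚ)
       refl N (M n) (Q n) (R n) (P n) ⟩
  N * (N * P n + P n + R n - Q n) + 2ℚ * 1ℚ
    ≡⟨ cong (λ x → N * (N * P n + P n + R n - Q n) + 2ℚ * x) (ι*recip n) ⟨
  N * (N * P n + P n + R n - Q n) + 2ℚ * (N * recip n)
    ≡⟨ solve 4 (λ N x c i → N :* x :+ c :* (N :* i) := N :* (x :+ c :* i))
         refl N (N * P n + P n + R n - Q n) 2ℚ (recip n) ⟩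
  N * (N * P n + P n + R n - Q n + 2ℚ * recip n) ∎)
  where
  open ≡-Reasoning
  N = ι (suc n)

-- Elimination of the auxiliary moments.

ι-2+ : ∀ n → ι (2 ℕ.+ n) ≡ 1ℚ + ι (suc n)
ι-2+ n = trans (ι-+ 1 (suc n)) (cong (_+ ι (suc n)) ι-1)

-- After substitution the coefficient of Q(n+1) is -N, and N Q(n+1) = N² Q + N (Q + M) cancels the
-- rest.
Q-recurrence : ∀ n → Q (2 ℕ.+ n) - 2ℚ * ι (2 ℕ.+ n) * Q (suc n) + suc² n * Q n ≡ 0ℚ
Q-recurrence n = eliminate (ι (suc n)) (Q n) (M n) (ι-2+ n) (M-suc n) (Q-suc n) (Q-suc (suc n))
  where
  -- With all values abstracted to variables, matching on `refl` performs the substitutions and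
  -- leaves a polynomial identity.
  eliminate : ∀ N x m {N′ x′ m′ x″} →
    N′ ≡ 1ℚ + N → m′ ≡ N * (x + m) → x′ ≡ N * x + x + m → x″ ≡ N′ * x′ + x′ + m′ →
    x″ - 2ℚ * N′ * x′ + N * N * x ≡ 0ℚ
  eliminate N x m refl refl refl refl =
    solve 3 (λ N x m →
      let x′ = N :* x :+ x :+ m in
      (con 1ℚ :+ N) :* x′ :+ x′ :+ N :* (x :+ m)
        :- con 2ℚ :* (con 1ℚ :+ N) :* x′ :+ N :* N :* x
      := con 0ℚ)
    refl N x m

-- M cancels in R(n+1) - Q(n+1) = N (R + P - Q) + 1, and this is N times the non-homogeneous part of
-- `P-suc` without 2/N, plus 1. Against -N P(n+1) there remain 2/(n+2), the 1, and -2 from N times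
-- 2/N.
P-recurrence : ∀ n → P (2 ℕ.+ n) - 2ℚ * ι (2 ℕ.+ n) * P (suc n) + suc² n * P n
             ≡ 2ℚ * recip (suc n) - 1ℚ
P-recurrence n = begin
  P (2 ℕ.+ n) - 2ℚ * ι (2 ℕ.+ n) * P (suc n) + suc² n * P n
    ≡⟨ eliminate (ι (suc n)) (Q n) (M n) (P n) (R n) (recip n) (recip (suc n))
         (ι-2+ n) (Q-suc n) (R-suc n) (P-suc n) (P-suc (suc n)) ⟩
  2ℚ * recip (suc n) + 1ℚ - 2ℚ * (ι (suc n) * recip n)
    ≡⟨ cong (λ x → 2ℚ * recip (suc n) + 1ℚ - 2ℚ * x) (ι*recip n) ⟩
  2ℚ * recip (suc n) + 1ℚ - 2ℚ * 1ℚ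
    ≡⟨ solve 1 (λ j → j :+ con 1ℚ :- con 2ℚ :* con 1ℚ := j :- con 1ℚ) refl (2ℚ * recip (suc n)) ⟩
  2ℚ * recip (suc n) - 1ℚ ∎
  where
  open ≡-Reasoning
  eliminate : ∀ N x m y z i i′ {N′ x′ z′ y′ y″} →
    N′ ≡ 1ℚ + N → x′ ≡ N * x + x + m → z′ ≡ N * (z + y) + m + x + 1ℚ →
    y′ ≡ N * y + y + z - x + 2ℚ * i → y″ ≡ N′ * y′ + y′ + z′ - x′ + 2ℚ * i′ →
    y″ - 2ℚ * N′ * y′ + N * N * y ≡ 2ℚ * i′ + 1ℚ - 2ℚ * (N * i)
  eliminate N x m y z i i′ refl refl refl refl refl =
    solve 7 (λ N x m y z i i′ →
      let y′ = N :* y :+ y :+ z :- x :+ con 2ℚ :* i in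
      (con 1ℚ :+ N) :* y′ :+ y′ :+ (N :* (z :+ y) :+ m :+ x :+ con 1ℚ) :- (N :* x :+ x :+ m)
        :+ con 2ℚ :* i′ :- con 2ℚ :* (con 1ℚ :+ N) :* y′ :+ N :* N :* y
      := con 2ℚ :* i′ :+ con 1ℚ :- con 2ℚ :* (N :* i))
    refl N x m y z i i′

-n/[2+n] : ∀ n → - (+ n / (2 ℕ.+ n)) ≡ 2ℚ * recip (suc n) - 1ℚ
-n/[2+n] n = begin
  - (+ n / (2 ℕ.+ n))
    ≡⟨ cong -_ (/-as-ι*recip n (suc n)) ⟩
  - (ι n * i)
    -- The numerator is written as n = (2 + n) - 2, so that 2 + n cancels the denominator.
    ≡⟨ solve 3 (λ x i c → :- (x :* i) := c :* i :- (c :+ x) :* i) refl (ι n) i 2ℚ ⟩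
  2ℚ * i - (2ℚ + ι n) * i
    ≡⟨ cong (λ x → 2ℚ * i - (x + ι n) * i) (ι-unfold 2) ⟨
  2ℚ * i - (ι 2 + ι n) * i
    ≡⟨ cong (λ x → 2ℚ * i - x * i) (ι-+ 2 n) ⟨
  2ℚ * i - ι (2 ℕ.+ n) * i
    ≡⟨ cong (λ x → 2ℚ * i - x) (ι*recip (suc n)) ⟩
  2ℚ * i - 1ℚ ∎
  where
  open ≡-Reasoning
  i = recip (suc n)

-- Return to `q`, `p` and the stated coefficients.

weight-nCk : ∀ {n} k m → k ℕ.+ m ≡ n → fromℕ ((n C k) ℕ.^ 2 ℕ.* k !) ≡ weight k m
weight-nCk k m refl = trans (sym (ι-unfold _)) (cong ι (sym (weightℕ-unfold k m)))

q≡Q : ∀ n → q n ≡ Q n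
q≡Q n = trans
  (sym (diagSum-unfold n (λ k _ → fromℕ ((n C k) ℕ.^ 2 ℕ.* k !))))
  (diagSum-cong n (λ k m eq → trans (weight-nCk k m eq) (sym (*-identityʳ (weight k m)))))

p≡P : ∀ n → p n ≡ P n
p≡P n = trans
  (sym (diagSum-unfold n (λ k m → fromℕ ((n C k) ℕ.^ 2 ℕ.* k !) * h k m)))
  (diagSum-cong n (λ k m eq → cong (_* h k m) (weight-nCk k m eq)))

linear-coefficient : ∀ n → fromℕ (2 ℕ.* (n ℕ.+ 2)) ≡ 2ℚ * ι (2 ℕ.+ n)
linear-coefficient n = trans (fromℕ-* 2 (n ℕ.+ 2))
  (cong (2ℚ *_) (trans (cong fromℕ (ℕ.+-comm n 2)) (sym (ι-unfold (2 ℕ.+ n)))))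

constant-coefficient : ∀ n → fromℕ ((n ℕ.+ 1) ℕ.^ 2) ≡ suc² n
constant-coefficient n = begin
  fromℕ ((n ℕ.+ 1) ℕ.^ 2)       ≡⟨ cong (λ x → fromℕ (x ℕ.^ 2)) (ℕ.+-comm n 1) ⟩
  fromℕ (suc n ℕ.^ 2)           ≡⟨ cong (λ x → fromℕ (suc n ℕ.* x)) (ℕ.*-identityʳ (suc n)) ⟩
  fromℕ (suc n ℕ.* suc n)       ≡⟨ ι-unfold (suc n ℕ.* suc n) ⟨
  ι (suc n ℕ.* suc n)           ≡⟨ ι-* (suc n) (suc n) ⟩
  suc² n                        ∎
  where open ≡-Reasoning

recurrence-cong : ∀ (f g : ℕ → ℚ) → (∀ n → f n ≡ g n) → ∀ n →
  f (2 ℕ.+ n) - fromℕ (2 ℕ.* (n ℕ.+ 2)) * f (1 ℕ.+ n) + fromℕ ((n ℕ.+ 1) ℕ.^ 2) * f n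
    ≡ g (2 ℕ.+ n) - 2ℚ * ι (2 ℕ.+ n) * g (suc n) + suc² n * g n
recurrence-cong f g f≡g n =
  combine (f≡g (2 ℕ.+ n)) (linear-coefficient n) (f≡g (suc n)) (constant-coefficient n) (f≡g n)
  where
  combine : ∀ {x x′ c c′ y y′ d d′ z z′} → x ≡ x′ → c ≡ c′ → y ≡ y′ → d ≡ d′ → z ≡ z′ →
    x - c * y + d * z ≡ x′ - c′ * y′ + d′ * z′
  combine refl refl refl refl refl = refl

lemma1 :
    ((∀ (n : ℕ) → q (2 ℕ.+ n) - fromℕ (2 ℕ.* (n ℕ.+ 2)) * q (1 ℕ.+ n) + fromℕ ((n ℕ.+ 1) ℕ.^ 2) * q n ≡ 0ℚ)
      × q 0 ≡ 1ℚ × q 1 ≡ fromℕ 2)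
    × ((∀ (n : ℕ) → p (2 ℕ.+ n) - fromℕ (2 ℕ.* (n ℕ.+ 2)) * p (1 ℕ.+ n) + fromℕ ((n ℕ.+ 1) ℕ.^ 2) * p n ≡ - (+ n / (2 ℕ.+ n)))
      × p 0 ≡ 0ℚ × p 1 ≡ 1ℚ)
lemma1 =
  -- The initial values are closed rationals, so evaluation settles them.
  ( (λ n → trans (recurrence-cong q Q q≡Q n) (Q-recurrence n)) , refl , refl )
  , ( (λ n → trans (recurrence-cong p P p≡P n) (trans (P-recurrence n) (sym (-n/[2+n] n)))) , refl , refl )
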